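{- Let $q\geq 3$ be a prime power and put $n=q^2+q-1$, $k=q^2-q-1$, $m=q^2-q$ (these are the number of items, the batch size and the number of servers of the $(q^2+q-1,\,q^3-q,\,q^2-q-1,\,q^2-q)$ combinatorial batch code $\mathcal{C}_{\mathrm{TD}}(q)$ whose servers are the points, and whose items are the blocks and groups, of a resolvable transversal design $\mathrm{TD}(q-1,q)$). Then $$n\leq \binom{m}{k-2}-(m-k+1)\,A(m,4,k-3).$$
   Context: $A(m,4,w)$ denotes the maximum number of codewords in a binary constant weight code of length $m$, constant weight $w$ and (minimum) Hamming distance $4$; i.e. the maximum size of a set of vectors in $\{0,1\}^m$, each having exactly $w$ ones, any two distinct ones of which are at Hamming distance at least $4$. -}

module Defs where

open import Data.Bool.Base using (Bool; true; false; _xor_)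
open import Data.Bool.Properties using () renaming (_≟_ to _≟ᵇ_)
open import Data.Fin.Subset using (∣_∣)
open import Data.List.Base using (List; []; _∷_; _++_; map; length; filter)
open import Data.List.Extrema.Nat using (max; argmax-sel; xs≤max)
open import Data.List.Membership.Propositional using (_∈_)
open import Data.List.Membership.Propositional.Properties
  using (∈-map⁺; ∈-map⁻; ∈-++⁺ˡ; ∈-++⁺ʳ; ∈-filter⁺; ∈-filter⁻)
import Data.List.Membership.DecPropositional as DecMembership
open import Data.List.Relation.Binary.BagAndSetEquality using (∼bag⇒↭)
open import Data.List.Membership.Propositional.Properties.WithK using (unique∧set⇒bag)
open import Data.List.Relation.Binary.Permutation.Propositional.Properties using (↭-length)
open import Data.List.Relation.Unary.All as All using (All; []; all?)
open import Data.List.Relation.Unary.AllPairs using ([]; _∷_)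
open import Data.List.Relation.Unary.Any using (here)
open import Data.List.Relation.Unary.Unique.Propositional using (Unique)
import Data.List.Relation.Unary.Unique.Propositional.Properties as Unique
import Data.List.Relation.Unary.Unique.DecPropositional as DecUnique
open import Data.Nat.Base using (ℕ; zero; suc; _≤_; _^_)
open import Data.Nat.Primality using (Prime)
open import Data.Nat.Properties using (_≟_; _≤?_)
open import Data.Product.Base using (∃; ∃₂; _×_; _,_; proj₂)
open import Data.Sum.Base using (inj₁; inj₂)
open import Data.Vec.Base using (Vec; []; _∷_; zipWith)
open import Data.Vec.Properties using (≡-dec; ∷-injectiveʳ)
open import Function.Base using (id)
open import Function.Bundles using (mk⇔)
open import Relation.Binary.Definitions using (DecidableEquality)
open import Relation.Binary.PropositionalEquality.Core using (_≡_; _≢_; refl; sym; subst)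
open import Relation.Nullary.Decidable using (Dec; yes; no; map′; ¬?; _×-dec_; _→-dec_)

IsPrimePower : ℕ → Set
IsPrimePower q = ∃₂ λ p e → Prime p × 1 ≤ e × q ≡ p ^ e

Word : ℕ → Set
Word = Vec Bool

-- ∣ x ∣ is the number of true entries of x.
weight : ∀ {m} → Word m → ℕ
weight x = ∣ x ∣

hamming : ∀ {m} → Word m → Word m → ℕ
hamming x y = weight (zipWith _xor_ x y)

-- A finite set of words is a duplicate-free list, so its size is its length.
record IsConstantWeightCode (m d w : ℕ) (c : List (Word m)) : Set where
  constructor mkCode
  field
    unique   : Unique c
    constant : ∀ {x} → x ∈ c → weight x ≡ w
    distance : ∀ {x y} → x ∈ c → y ∈ c → x ≢ y → d ≤ hamming x y

_≟ʷ_ : ∀ {m} → DecidableEquality (Word m)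
_≟ʷ_ = ≡-dec _≟ᵇ_

isConstantWeightCode? : ∀ m d w c → Dec (IsConstantWeightCode m d w c)
isConstantWeightCode? m d w c = map′ to from
  (DecUnique.unique? _≟ʷ_ c ×-dec
   all? (λ x → weight x ≟ w) c ×-dec
   all? (λ x → all? (λ y → ¬? (x ≟ʷ y) →-dec (d ≤? hamming x y)) c) c)
  where
  Listed : Set
  Listed = Unique c × All (λ x → weight x ≡ w) c
         × All (λ x → All (λ y → x ≢ y → d ≤ hamming x y) c) c

  to : Listed → IsConstantWeightCode m d w c
  to (u , ws , ds) = mkCode u (All.lookup ws)
    (λ x∈c y∈c → All.lookup (All.lookup ds x∈c) y∈c)

  from : IsConstantWeightCode m d w c → Listed
  from (mkCode u ws ds) = u , All.tabulate ws ,
    All.tabulate (λ x∈c → All.tabulate (λ y∈c → ds x∈c y∈c))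

words : ∀ m → List (Word m)
words zero    = [] ∷ []
words (suc m) = map (false ∷_) (words m) ++ map (true ∷_) (words m)

sublists : ∀ {A : Set} → List A → List (List A)
sublists []       = [] ∷ []
sublists (x ∷ xs) = sublists xs ++ map (x ∷_) (sublists xs)

constantWeightCodes : ∀ m → ℕ → ℕ → List (List (Word m))
constantWeightCodes m d w = filter (isConstantWeightCode? m d w) (sublists (words m))

-- The value 0 is always attained, by the empty code; see A-attained and A-maximal.
A : ℕ → ℕ → ℕ → ℕ
A m d w = max 0 (map length (constantWeightCodes m d w))

∈-words : ∀ {m} (x : Word m) → x ∈ words m
∈-words []                  = here refl
∈-words (false ∷ x)         = ∈-++⁺ˡ (∈-map⁺ (false ∷_) (∈-words x))
∈-words {suc m} (true ∷ x)  = ∈-++⁺ʳ (map (false ∷_) (words m)) (∈-map⁺ (true ∷_) (∈-words x))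

words-unique : ∀ m → Unique (words m)
words-unique zero    = [] ∷ []
words-unique (suc m) = Unique.++⁺
  (Unique.map⁺ ∷-injectiveʳ (words-unique m))
  (Unique.map⁺ ∷-injectiveʳ (words-unique m))
  disjoint
  where
  disjoint : ∀ {x} → x ∈ map (false ∷_) (words m) × x ∈ map (true ∷_) (words m) → _
  disjoint (p , q) with ∈-map⁻ (false ∷_) p | ∈-map⁻ (true ∷_) q
  ... | _ , _ , refl | _ , _ , ()

filter∈sublists : ∀ {A : Set} {P : A → Set} (P? : ∀ x → Dec (P x)) xs →
                  filter P? xs ∈ sublists xs
filter∈sublists P? []       = here refl
filter∈sublists P? (x ∷ xs) with P? x
... | yes _ = ∈-++⁺ʳ (sublists xs) (∈-map⁺ (x ∷_) (filter∈sublists P? xs))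
... | no  _ = ∈-++⁺ˡ (filter∈sublists P? xs)

A-attained : ∀ m d w → ∃ λ c → IsConstantWeightCode m d w c × length c ≡ A m d w
A-attained m d w with argmax-sel id 0 (map length (constantWeightCodes m d w))
... | inj₁ A≡0 = [] , mkCode [] (λ ()) (λ ()) , sym A≡0
... | inj₂ A∈ with ∈-map⁻ length A∈
...   | c , c∈ , eq =
        c , proj₂ (∈-filter⁻ (isConstantWeightCode? m d w) {xs = sublists (words m)} c∈) , sym eq

A-maximal : ∀ {m d w c} → IsConstantWeightCode m d w c → length c ≤ A m d w
A-maximal {m} {d} {w} {c} (mkCode u ws ds) =
  subst (_≤ A m d w) (↭-length c′↭c)
    (All.lookup (xs≤max 0 (map length (constantWeightCodes m d w)))
      (∈-map⁺ length
        (∈-filter⁺ (isConstantWeightCode? m d w)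
          (filter∈sublists (_∈? c) (words m)) c′-code)))
  where
  open DecMembership (_≟ʷ_ {m}) using (_∈?_)

  c′ : List (Word m)
  c′ = filter (_∈? c) (words m)

  to : ∀ {x} → x ∈ c′ → x ∈ c
  to x∈c′ = proj₂ (∈-filter⁻ (_∈? c) {xs = words m} x∈c′)

  c′-unique : Unique c′
  c′-unique = Unique.filter⁺ (_∈? c) (words-unique m)

  c′-code : IsConstantWeightCode m d w c′
  c′-code = mkCode c′-unique (λ x∈ → ws (to x∈)) (λ x∈ y∈ → ds (to x∈) (to y∈))

  c′↭c = ∼bag⇒↭ (unique∧set⇒bag c′-unique u
    (mk⇔ to (λ x∈c → ∈-filter⁺ (_∈? c) (∈-words _) x∈c)))

{-# OPTIONS --safe #-}

-- Here m ∸ k + 1 = 2, k ∸ 2 = m ∸ 3 and k ∸ 3 = m ∸ 4, so the claim is n + 2 A(m,4,m-4) ≤ C(m,3).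
-- Raising one zero of a codeword of weight w to a one gives m - w words of weight w+1,
-- and words raised from distinct codewords of a distance-4 code are distinct; hence
-- (m - w) A(m,4,w) ≤ C(m,w+1). For w = m-4 this bounds 2 A(m,4,m-4) by half of C(m,3),
-- which leaves enough room for n once q ≥ 4. For q = 3 it only gives A(6,4,2) ≤ 5, one too
-- many; complementing the code first gives 2 A(6,4,2) ≤ 2 A(6,4,4) ≤ C(6,5) = 6.
module Submission where

open import Defs using
  (IsPrimePower; Word; weight; hamming; IsConstantWeightCode; mkCode; A; A-attained; A-maximal)
open import Data.Bool.Base using (true; false)
open import Data.Bool.Properties using (not-injective)
open import Data.Fin.Subset using (∁)
open import Data.Fin.Subset.Properties using (∣∁p∣≡n∸∣p∣)
open import Data.Integer.Base as ℤ using (+_)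
open import Data.Integer.Properties using (pos-*; m-n≡m⊖n; ⊖-≥)
open import Data.List.Base using (List; []; _∷_; _++_; map; length; concatMap)
open import Data.List.Membership.Propositional using (_∈_)
open import Data.List.Membership.Propositional.Properties
  using (∈-map⁺; ∈-map⁻; ∈-++⁺ˡ; ∈-++⁺ʳ; ∈-∃++; ∈-concat⁻′)
open import Data.List.Properties using (length-map; length-++)
open import Data.List.Relation.Binary.Disjoint.Propositional using (Disjoint)
open import Data.List.Relation.Binary.Permutation.Propositional.Properties
  using (shift; ↭-length; ∈-resp-↭)
open import Data.List.Relation.Binary.Subset.Propositional using (_⊆_)
open import Data.List.Relation.Unary.All as All using ([]; _∷_)
import Data.List.Relation.Unary.All.Properties as All
open import Data.List.Relation.Unary.AllPairs using (AllPairs; []; _∷_)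
open import Data.List.Relation.Unary.Any using (here; there)
open import Data.List.Relation.Unary.Unique.Propositional using (Unique)
import Data.List.Relation.Unary.Unique.Propositional.Properties as Unique
open import Data.Nat.Base
  using (ℕ; zero; suc; _+_; _*_; _∸_; _^_; _≤_; _<_; z≤n; s≤s)
open import Data.Nat.Combinatorics using (_C_; nCk+nC[k+1]≡[n+1]C[k+1]; nC1≡n; nCk≡nC[n∸k])
open import Data.Nat.Properties
open import Data.Nat.Tactic.RingSolver using (solve-∀)
open import Data.Product.Base using (_,_)
open import Data.Sum.Base using (inj₁; inj₂)
open import Data.Vec.Base using ([]; _∷_)
open import Data.Vec.Properties using (∷-injectiveʳ; ∷-injective)
open import Function.Base using (_∘_)
open import Relation.Binary.PropositionalEquality
  using (_≡_; _≢_; refl; sym; trans; cong; cong₂; subst; module ≡-Reasoning)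
open import Relation.Nullary.Negation using (contradiction)

-- Counting in duplicate-free lists.

module _ {X : Set} where

  -- Induction on `xs`: delete one occurrence of `x` from `ys`. The remaining entries of `xs` differ
  -- from `x`, so they survive the deletion.
  unique-⊆⇒length≤ : {xs ys : List X} → Unique xs → xs ⊆ ys → length xs ≤ length ys
  unique-⊆⇒length≤ []       _ = z≤n
  unique-⊆⇒length≤ {x ∷ xs} (x∉xs ∷ u) x∷xs⊆ys with ∈-∃++ (x∷xs⊆ys (here refl))
  ... | as , bs , refl = begin
    suc (length xs)          ≤⟨ s≤s (unique-⊆⇒length≤ u xs⊆as++bs) ⟩
    suc (length (as ++ bs))  ≡⟨ ↭-length (shift x as bs) ⟨
    length (as ++ x ∷ bs)    ∎
    where
    open ≤-Reasoning
    xs⊆as++bs : xs ⊆ as ++ bs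
    xs⊆as++bs z∈xs with ∈-resp-↭ (shift x as bs) (x∷xs⊆ys (there z∈xs))
    ... | here z≡x      = contradiction (sym z≡x) (All.lookup x∉xs z∈xs)
    ... | there z∈as++bs = z∈as++bs

  length-concatMap-const : ∀ {Y : Set} (f : X → List Y) {n} xs →
    (∀ {x} → x ∈ xs → length (f x) ≡ n) → length (concatMap f xs) ≡ length xs * n
  length-concatMap-const f []       _ = refl
  length-concatMap-const f (x ∷ xs) h = trans (length-++ (f x))
    (cong₂ _+_ (h (here refl)) (length-concatMap-const f xs (h ∘ there)))

-- Words of fixed weight.

wordsOfWeight : ∀ m → ℕ → List (Word m)
wordsOfWeight zero    zero    = [] ∷ []
wordsOfWeight zero    (suc w) = []
wordsOfWeight (suc m) zero    = map (false ∷_) (wordsOfWeight m 0)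
wordsOfWeight (suc m) (suc w) =
  map (true ∷_) (wordsOfWeight m w) ++ map (false ∷_) (wordsOfWeight m (suc w))

length-wordsOfWeight : ∀ m w → length (wordsOfWeight m w) ≡ m C w
length-wordsOfWeight zero    zero    = refl
length-wordsOfWeight zero    (suc w) = refl
length-wordsOfWeight (suc m) zero    =
  trans (length-map _ (wordsOfWeight m 0)) (length-wordsOfWeight m 0)
length-wordsOfWeight (suc m) (suc w) = begin
  length (map (true ∷_) xs ++ map (false ∷_) ys)  ≡⟨ length-++ (map _ xs) ⟩
  length (map (true ∷_) xs) + length (map (false ∷_) ys)
    ≡⟨ cong₂ _+_ (length-map _ xs) (length-map _ ys) ⟩
  length xs + length ys  ≡⟨ cong₂ _+_ (length-wordsOfWeight m w) (length-wordsOfWeight m (suc w)) ⟩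
  m C w + m C suc w      ≡⟨ nCk+nC[k+1]≡[n+1]C[k+1] m w ⟩
  suc m C suc w          ∎
  where
  open ≡-Reasoning
  xs = wordsOfWeight m w
  ys = wordsOfWeight m (suc w)

∈-wordsOfWeight : ∀ {m} (x : Word m) → x ∈ wordsOfWeight m (weight x)
∈-wordsOfWeight []          = here refl
∈-wordsOfWeight (true ∷ x)  = ∈-++⁺ˡ (∈-map⁺ (true ∷_) (∈-wordsOfWeight x))
-- `wordsOfWeight (suc m)` unfolds only once the weight is known to be zero or a successor.
∈-wordsOfWeight {suc m} (false ∷ x) with weight x | ∈-wordsOfWeight x
... | zero  | x∈ = ∈-map⁺ (false ∷_) x∈
... | suc w | x∈ = ∈-++⁺ʳ (map (true ∷_) (wordsOfWeight m w)) (∈-map⁺ (false ∷_) x∈)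

-- Raising one zero of a word to a one.

raisings : ∀ {m} → Word m → List (Word m)
raisings []          = []
raisings (true ∷ x)  = map (true ∷_) (raisings x)
raisings (false ∷ x) = (true ∷ x) ∷ map (false ∷_) (raisings x)

-- There is one raising for each zero. The additive form keeps truncated subtraction out of the
-- induction.
length-raisings : ∀ {m} (x : Word m) → length (raisings x) + weight x ≡ m
length-raisings []          = refl
length-raisings (true ∷ x)  = trans (+-suc _ (weight x))
  (cong suc (trans (cong (_+ weight x) (length-map _ (raisings x))) (length-raisings x)))
length-raisings (false ∷ x) =
  cong suc (trans (cong (_+ weight x) (length-map _ (raisings x))) (length-raisings x))

raisings-unique : ∀ {m} (x : Word m) → Unique (raisings x)
raisings-unique []          = []
raisings-unique (true ∷ x)  = Unique.map⁺ ∷-injectiveʳ (raisings-unique x)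
raisings-unique (false ∷ x) =
  All.map⁺ (All.universal (λ _ ()) (raisings x)) ∷ Unique.map⁺ ∷-injectiveʳ (raisings-unique x)

weight-raising : ∀ {m} (x : Word m) {z} → z ∈ raisings x → weight z ≡ suc (weight x)
weight-raising (true ∷ x)  z∈ with ∈-map⁻ (true ∷_) z∈
... | _ , y∈ , refl = cong suc (weight-raising x y∈)
weight-raising (false ∷ x) (here refl) = refl
weight-raising (false ∷ x) (there z∈) with ∈-map⁻ (false ∷_) z∈
... | _ , y∈ , refl = weight-raising x y∈

-- Hamming distance and raisings.

hamming-refl : ∀ {m} (x : Word m) → hamming x x ≡ 0
hamming-refl []          = refl
hamming-refl (true ∷ x)  = hamming-refl x
hamming-refl (false ∷ x) = hamming-refl x

hamming-raising : ∀ {m} (x : Word m) {z} → z ∈ raisings x → hamming x z ≡ 1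
hamming-raising (true ∷ x)  z∈ with ∈-map⁻ (true ∷_) z∈
... | _ , y∈ , refl = hamming-raising x y∈
hamming-raising (false ∷ x) (here refl) = cong suc (hamming-refl x)
hamming-raising (false ∷ x) (there z∈) with ∈-map⁻ (false ∷_) z∈
... | _ , y∈ , refl = hamming-raising x y∈

-- Coordinatewise: where `x` and `y` differ, `z` differs from exactly one of them. Both distances on
-- the right end in `z`, the shape that fits a common raising of `x` and `y`.
hamming-triangle : ∀ {m} (x y z : Word m) → hamming x y ≤ hamming x z + hamming y z
hamming-triangle []          []          []          = z≤n
hamming-triangle (true ∷ x)  (true ∷ y)  (true ∷ z)  = hamming-triangle x y z
hamming-triangle (true ∷ x)  (true ∷ y)  (false ∷ z) =
  ≤-trans (hamming-triangle x y z) (+-mono-≤ (n≤1+n _) (n≤1+n _))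
hamming-triangle (true ∷ x)  (false ∷ y) (true ∷ z)  =
  ≤-trans (s≤s (hamming-triangle x y z)) (≤-reflexive (sym (+-suc _ _)))
hamming-triangle (true ∷ x)  (false ∷ y) (false ∷ z) = s≤s (hamming-triangle x y z)
hamming-triangle (false ∷ x) (true ∷ y)  (true ∷ z)  = s≤s (hamming-triangle x y z)
hamming-triangle (false ∷ x) (true ∷ y)  (false ∷ z) =
  ≤-trans (s≤s (hamming-triangle x y z)) (≤-reflexive (sym (+-suc _ _)))
hamming-triangle (false ∷ x) (false ∷ y) (true ∷ z)  =
  ≤-trans (hamming-triangle x y z) (+-mono-≤ (n≤1+n _) (n≤1+n _))
hamming-triangle (false ∷ x) (false ∷ y) (false ∷ z) = hamming-triangle x y z

-- A common raising is at distance 1 from both words, which would put them at distance at most 2.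
raisings-disjoint : ∀ {m} (x y : Word m) → 2 < hamming x y → Disjoint (raisings x) (raisings y)
raisings-disjoint x y 2<xy {z} (z∈x , z∈y) = <⇒≱ 2<xy
  (subst (hamming x y ≤_) (cong₂ _+_ (hamming-raising x z∈x) (hamming-raising y z∈y))
    (hamming-triangle x y z))

-- Bounding codes of distance 4 by counting raised words.

code-length-bound : ∀ {m w c} → IsConstantWeightCode m 4 w c → length c * (m ∸ w) ≤ m C suc w
code-length-bound {m} {w} {c} (mkCode unique constant distance) = begin
  length c * (m ∸ w)               ≡⟨ length-concatMap-const raisings c count ⟨
  length (concatMap raisings c)    ≤⟨ unique-⊆⇒length≤ raised-unique raised-weight ⟩
  length (wordsOfWeight m (suc w)) ≡⟨ length-wordsOfWeight m (suc w) ⟩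
  m C suc w                        ∎
  where
  open ≤-Reasoning
  count : ∀ {x} → x ∈ c → length (raisings x) ≡ m ∸ w
  count {x} x∈c = trans (sym (m+n∸n≡m (length (raisings x)) (weight x)))
    (cong₂ _∸_ (length-raisings x) (constant x∈c))

  -- The recursion runs over tails of `c`, while `distance` speaks of members of `c`; hence the
  -- inclusion is carried along.
  disjoint : ∀ {xs} → Unique xs → xs ⊆ c → AllPairs Disjoint (map raisings xs)
  disjoint []               _    = []
  disjoint {x ∷ _} (x∉ ∷ u) xs⊆c =
    All.map⁺ (All.tabulate λ {y} y∈ → raisings-disjoint x y
      -- `2 < hamming x y` unfolds to `3 ≤ hamming x y`, which weakens distance 4.
      (≤-trans (n≤1+n 3) (distance (xs⊆c (here refl)) (xs⊆c (there y∈)) (All.lookup x∉ y∈))))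
    ∷ disjoint u (xs⊆c ∘ there)

  raised-unique : Unique (concatMap raisings c)
  raised-unique = Unique.concat⁺ (All.map⁺ (All.universal raisings-unique c))
    (disjoint unique (λ x∈c → x∈c))

  raised-weight : concatMap raisings c ⊆ wordsOfWeight m (suc w)
  raised-weight {z} z∈ with ∈-concat⁻′ (map raisings c) z∈
  ... | _ , z∈x , x∈ with ∈-map⁻ raisings x∈
  ...   | x , x∈c , refl = subst (λ v → z ∈ wordsOfWeight m v)
    (trans (weight-raising x z∈x) (cong suc (constant x∈c))) (∈-wordsOfWeight z)

A-bound : ∀ m w → A m 4 w * (m ∸ w) ≤ m C suc w
A-bound m w with A-attained m 4 w
... | c , code , length≡A = subst (λ a → a * (m ∸ w) ≤ m C suc w) length≡A (code-length-bound code)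

-- Complements of codes.

∁-injective : ∀ {m} {x y : Word m} → ∁ x ≡ ∁ y → x ≡ y
∁-injective {x = []}    {[]}    _  = refl
∁-injective {x = a ∷ x} {b ∷ y} eq with ∷-injective eq
... | a≡b , x≡y = cong₂ _∷_ (not-injective a≡b) (∁-injective x≡y)

hamming-∁ : ∀ {m} (x y : Word m) → hamming (∁ x) (∁ y) ≡ hamming x y
hamming-∁ []          []          = refl
hamming-∁ (true ∷ x)  (true ∷ y)  = hamming-∁ x y
hamming-∁ (true ∷ x)  (false ∷ y) = cong suc (hamming-∁ x y)
hamming-∁ (false ∷ x) (true ∷ y)  = cong suc (hamming-∁ x y)
hamming-∁ (false ∷ x) (false ∷ y) = hamming-∁ x y

∁-code : ∀ {m d w c} → IsConstantWeightCode m d w c → IsConstantWeightCode m d (m ∸ w) (map ∁ c)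
∁-code {m} {d} {w} {c} (mkCode unique constant distance) =
  mkCode (Unique.map⁺ ∁-injective unique) constant′ distance′
  where
  constant′ : ∀ {x} → x ∈ map ∁ c → weight x ≡ m ∸ w
  constant′ x∈ with ∈-map⁻ ∁ x∈
  ... | x , x∈c , refl = trans (∣∁p∣≡n∸∣p∣ x) (cong (m ∸_) (constant x∈c))

  distance′ : ∀ {x y} → x ∈ map ∁ c → y ∈ map ∁ c → x ≢ y → d ≤ hamming x y
  distance′ x∈ y∈ ∁x≢∁y with ∈-map⁻ ∁ x∈ | ∈-map⁻ ∁ y∈
  ... | x , x∈c , refl | y , y∈c , refl =
    subst (d ≤_) (sym (hamming-∁ x y)) (distance x∈c y∈c (∁x≢∁y ∘ cong ∁))

-- Complementing an optimal code preserves its size and its distances.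
A-∁ : ∀ m d w → A m d w ≤ A m d (m ∸ w)
A-∁ m d w with A-attained m d w
... | c , code , length≡A = subst (_≤ A m d (m ∸ w)) (trans (length-map ∁ c) length≡A)
  (A-maximal (∁-code code))

-- A complemented codeword has `w` zeros, so raising now gives the factor `w` in place of `m ∸ w`.
A-bound-∁ : ∀ m {w} → w ≤ m → A m 4 w * w ≤ m C suc (m ∸ w)
A-bound-∁ m {w} w≤m = begin
  A m 4 w * w                    ≤⟨ *-monoˡ-≤ w (A-∁ m 4 w) ⟩
  A m 4 (m ∸ w) * w              ≡⟨ cong (A m 4 (m ∸ w) *_) (m∸[m∸n]≡n w≤m) ⟨
  A m 4 (m ∸ w) * (m ∸ (m ∸ w))  ≤⟨ A-bound m (m ∸ w) ⟩
  m C suc (m ∸ w)                ∎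
  where open ≤-Reasoning

-- Binomial estimates and the inequality over the naturals.

n≤[1+n]C2 : ∀ n → n ≤ suc n C 2
n≤[1+n]C2 n = begin
  n              ≡⟨ nC1≡n n ⟨
  n C 1          ≤⟨ m≤m+n (n C 1) (n C 2) ⟩
  n C 1 + n C 2  ≡⟨ nCk+nC[k+1]≡[n+1]C[k+1] n 1 ⟩
  suc n C 2      ∎
  where open ≤-Reasoning

-- Increasing `m` by one adds 4 on the left and `m C 2`, at least `m ∸ 1`, on the right. The
-- induction starts at 7 because `4 * 6` exceeds `6 C 3 = 20`.
4*[7+n]≤[7+n]C3 : ∀ n → 4 * (7 + n) ≤ (7 + n) C 3
4*[7+n]≤[7+n]C3 zero    = ≤ᵇ⇒≤ 28 35 _
4*[7+n]≤[7+n]C3 (suc n) = begin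
  4 * (8 + n)                  ≡⟨ *-suc 4 (7 + n) ⟩
  4 + 4 * (7 + n)              ≤⟨ +-mono-≤ (≤-trans (m≤m+n 4 (2 + n)) (n≤[1+n]C2 (6 + n)))
                                           (4*[7+n]≤[7+n]C3 n) ⟩
  (7 + n) C 2 + (7 + n) C 3    ≡⟨ nCk+nC[k+1]≡[n+1]C[k+1] (7 + n) 2 ⟩
  (8 + n) C 3                  ∎
  where open ≤-Reasoning

-- Codewords of weight `m ∸ 4` have four zeros, which gives the factor 4. The raised words have
-- weight `m ∸ 3`, and symmetry of binomials turns their number into `m C 3`.
A-bound₄ : ∀ m → 4 ≤ m → 4 * A m 4 (m ∸ 4) ≤ m C 3
A-bound₄ m@(suc (suc (suc (suc t)))) 4≤m@(s≤s (s≤s (s≤s (s≤s _)))) = begin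
  4 * a             ≡⟨ *-comm 4 a ⟩
  a * 4             ≡⟨ cong (a *_) (m∸[m∸n]≡n 4≤m) ⟨
  a * (m ∸ t)       ≤⟨ A-bound m t ⟩
  m C (m ∸ 3)       ≡⟨ nCk≡nC[n∸k] {3} {m} (m≤m+n 3 (suc t)) ⟨
  m C 3             ∎
  where
  open ≤-Reasoning
  a = A m 4 t

-- After doubling, `2 * n ≤ 4 * m` and `4 * A m 4 (m ∸ 4)` are each at most `m C 3`.
n+2A≤mC3 : ∀ m n → 7 ≤ m → n ≤ 2 * m → n + 2 * A m 4 (m ∸ 4) ≤ m C 3
n+2A≤mC3 m n 7≤m n≤2m = *-cancelˡ-≤ 2 (begin
  2 * (n + 2 * a)          ≤⟨ *-monoʳ-≤ 2 (+-monoˡ-≤ (2 * a) n≤2m) ⟩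
  2 * (2 * m + 2 * a)      ≡⟨ distribute m a ⟩
  4 * m + 4 * a            ≤⟨ +-mono-≤ 4m≤mC3 (A-bound₄ m (≤-trans (m≤m+n 4 3) 7≤m)) ⟩
  m C 3 + m C 3            ≡⟨ cong (_+_ (m C 3)) (+-identityʳ (m C 3)) ⟨
  2 * (m C 3)              ∎)
  where
  open ≤-Reasoning
  a = A m 4 (m ∸ 4)
  distribute : ∀ m a → 2 * (2 * m + 2 * a) ≡ 4 * m + 4 * a
  distribute = solve-∀
  4m≤mC3 : 4 * m ≤ m C 3
  4m≤mC3 = subst (λ m → 4 * m ≤ m C 3) (m+[n∸m]≡n 7≤m) (4*[7+n]≤[7+n]C3 (m ∸ 7))

-- The value of A is kept abstract as a: with closed arguments Agda would try to evaluate A.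
n+2a≤mC3-for-m≡6 : ∀ {m n} a → m ≡ 6 → n ≡ 11 →
  a * (m ∸ 4) ≤ m C suc (m ∸ (m ∸ 4)) → n + 2 * a ≤ m C 3
n+2a≤mC3-for-m≡6 a refl refl a*2≤6 = begin
  11 + 2 * a  ≡⟨ cong (_+_ 11) (*-comm 2 a) ⟩
  11 + a * 2  ≤⟨ +-monoʳ-≤ 11 a*2≤6 ⟩
  17          ≤⟨ m≤m+n 17 3 ⟩
  20          ∎
  where open ≤-Reasoning

-- Passage to the integers.

ℤ-form : ∀ m n → 4 ≤ m → n + 2 * A m 4 (m ∸ 4) ≤ m C 3 →
  + n ℤ.≤ + (m C (m ∸ 1 ∸ 2)) ℤ.- (+ m ℤ.- + (m ∸ 1) ℤ.+ + 1) ℤ.* + (A m 4 (m ∸ 1 ∸ 3))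
-- `k` is `m ∸ 1`, as in the theorem. Exposing four successors makes the truncated subtractions
-- compute: `k ∸ 2` is `suc t` and `k ∸ 3` is `t`.
ℤ-form m@(suc k@(suc (suc (suc t)))) n (s≤s (s≤s (s≤s (s≤s _)))) h =
  subst (+ n ℤ.≤_) (sym rhs≡) (ℤ.+≤+ (m+n≤o⇒m≤o∸n n h′))
  where
  open ≡-Reasoning
  a = A m 4 t
  b = m C suc t

  h′ : n + 2 * a ≤ b
  h′ = subst (n + 2 * a ≤_) (nCk≡nC[n∸k] {3} {m} (m≤m+n 3 (suc t))) h

  m-k≡1 : + m ℤ.- + k ≡ + 1
  m-k≡1 = begin
    + m ℤ.- + k  ≡⟨ m-n≡m⊖n m k ⟩
    m ℤ.⊖ k      ≡⟨ ⊖-≥ (n≤1+n k) ⟩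
    + (m ∸ k)    ≡⟨ cong +_ (m+n∸n≡m 1 k) ⟩
    + 1          ∎

  rhs≡ : + b ℤ.- (+ m ℤ.- + k ℤ.+ + 1) ℤ.* + a ≡ + (b ∸ 2 * a)
  rhs≡ = begin
    + b ℤ.- (+ m ℤ.- + k ℤ.+ + 1) ℤ.* + a
      ≡⟨ cong (λ i → + b ℤ.- (i ℤ.+ + 1) ℤ.* + a) m-k≡1 ⟩
    + b ℤ.- + 2 ℤ.* + a  ≡⟨ cong (λ i → + b ℤ.- i) (pos-* 2 a) ⟨
    + b ℤ.- + (2 * a)    ≡⟨ m-n≡m⊖n b (2 * a) ⟩
    -- Nothing is truncated, since `h′` yields `2 * a ≤ b`.
    b ℤ.⊖ 2 * a          ≡⟨ ⊖-≥ (m+n≤o⇒n≤o n h′) ⟩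
    + (b ∸ 2 * a)        ∎

-- The parameters as functions of `q`.

q^2∸q : ∀ p → suc p ^ 2 ∸ suc p ≡ suc p * p
q^2∸q p = begin
  suc p ^ 2 ∸ suc p            ≡⟨ cong (_∸ suc p) (square p) ⟩
  suc p * p + suc p ∸ suc p    ≡⟨ m+n∸n≡m (suc p * p) (suc p) ⟩
  suc p * p                    ∎
  where
  open ≡-Reasoning
  square : ∀ p → suc p * (suc p * 1) ≡ suc p * p + suc p
  square = solve-∀

theorem14 : ∀ (q : ℕ) → 3 ≤ q → IsPrimePower q →
    let n = q ^ 2 + q ∸ 1
        k = q ^ 2 ∸ q ∸ 1
        m = q ^ 2 ∸ q
    in + n ℤ.≤ + (m C (k ∸ 2)) ℤ.- (+ m ℤ.- + k ℤ.+ + 1) ℤ.* + (A m 4 (k ∸ 3))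
theorem14 q 3≤q _ with m≤n⇒m<n∨m≡n 3≤q
-- Here the weight `m ∸ 4` is 2. The equation `3≡q` is not matched, so the arguments of `A` stay
-- symbolic.
... | inj₂ 3≡q = ℤ-form m n (subst (4 ≤_) (sym m≡6) (m≤m+n 4 2))
  (n+2a≤mC3-for-m≡6 (A m 4 (m ∸ 4)) m≡6 n≡11 (A-bound-∁ m (m∸n≤m m 4)))
  where
  n = q ^ 2 + q ∸ 1
  m = q ^ 2 ∸ q

  m≡6 : m ≡ 6
  m≡6 = cong (λ q → q ^ 2 ∸ q) (sym 3≡q)

  n≡11 : n ≡ 11
  n≡11 = cong (λ q → q ^ 2 + q ∸ 1) (sym 3≡q)
... | inj₁ 4≤q = ℤ-form m n (≤-trans (m≤m+n 4 3) 7≤m) (n+2A≤mC3 m n 7≤m n≤2m)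
  where
  open ≤-Reasoning
  n = q ^ 2 + q ∸ 1
  m = q ^ 2 ∸ q
  j = q ∸ 4

  q≡4+j : q ≡ 4 + j
  q≡4+j = sym (m+[n∸m]≡n 4≤q)

  m≡ : m ≡ (4 + j) * (3 + j)
  m≡ = trans (cong (λ q → q ^ 2 ∸ q) q≡4+j) (q^2∸q (3 + j))

  7≤m : 7 ≤ m
  7≤m = begin
    7                  ≤⟨ m≤m+n 7 5 ⟩
    4 * 3              ≤⟨ *-mono-≤ (m≤m+n 4 j) (m≤m+n 3 j) ⟩
    (4 + j) * (3 + j)  ≡⟨ m≡ ⟨
    m                  ∎

  n≤2m : n ≤ 2 * m
  n≤2m = begin
    n                                          ≤⟨ m∸n≤m (q ^ 2 + q) 1 ⟩
    q ^ 2 + q                                  ≡⟨ cong (λ q → q ^ 2 + q) q≡4+j ⟩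
    -- The added term is the gap `2 * m - (q ^ 2 + q) = q * (q - 3)`, that is `(4 + j) * (1 + j)`.
    (4 + j) ^ 2 + (4 + j)                      ≤⟨ m≤m+n _ (4 + 5 * j + j * j) ⟩
    (4 + j) ^ 2 + (4 + j) + (4 + 5 * j + j * j) ≡⟨ expand j ⟩
    2 * ((4 + j) * (3 + j))                    ≡⟨ cong (2 *_) m≡ ⟨
    2 * m                                      ∎
    where
    expand : ∀ j → (4 + j) * ((4 + j) * 1) + (4 + j) + (4 + 5 * j + j * j) ≡
                   2 * ((4 + j) * (3 + j))
    expand = solve-∀
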